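{- Let $G=(V,E)$ be a function graph satisfying the standing assumptions in the context. Let $S\subseteq V$ be a maximal clique of $G$, let $N(S)\subseteq\overline S$ be the set of neighbors of $S$, and let $\mathcal C=\{C_i\}$ be the set of (vertex sets of) connected components of the subgraph induced on $V\setminus(S\cup N(S))$. Let $L$ and $R$ be the unions of the vertices of those $C_i$ that are at the left, respectively at the right, of $S$. Then $L\leq V$ and $R\geq V$. Moreover, the following algorithm produces $L$ and $R$: construct the auxiliary graph $Q$ with vertex set $\mathcal C$, in which $C_iC_j$ ($i\ne j$) is an edge iff some $v\in N(S)$ is adjacent both to a vertex of $C_i$ and to a vertex of $C_j$; then the unions $\bigcup_{C\in\mathcal C'}C$ over the connected components $\mathcal C'$ of $Q$ are exactly the nonempty sets among $L,R$.
   Context: A finite simple graph $G=(V,E)$ is a function graph if each vertex $v\in V$ can be assigned a continuous function $t\mapsto v(t)\in\mathbb{R}$ on a common interval $I$ ($I=[0,1]$ or $I=\mathbb{R}$) such that, for distinct $u,v\in V$, $uv\in E$ iff $u(t)=v(t)$ for some $t\in I$. Such a family of functions is fixed. Write $u<v$ (equivalently $v>u$) if $u(t)<v(t)$ for all $t\in I$. $\overline S=V\setminus S$. For two vertex sets $A,B$, "$A$ is at the left of $B$" (equivalently, $B$ is at the right of $A$) means $a<b$ for all $a\in A$, $b\in B$. Each $C_i$ is a connected set with no edges to the connected set $S$, and is therefore either at the left or at the right of $S$. $S\leq V$ ("$S$ is a lower bound") means: for all $u\in S$, $w\in V\setminus S$ with $uw\notin E$ one has $u<w$. $S\geq V$ ("$S$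 is an upper bound") means: for all $u\in S$, $w\in V\setminus S$ with $uw\notin E$ one has $u>w$. Standing assumptions: a module is a set $M\subseteq V$ with $|M|>1$ such that each vertex outside $M$ is adjacent to all or to none of the vertices of $M$; $G$ is assumed to have no module other than $V$ itself. $G$ is also assumed to be connected. -}

module Defs where

open import Data.Fin using (Fin)
open import Data.Fin.Subset using (Subset; _∈_; _∉_; _⊆_; ∣_∣; ⊤)
open import Data.Nat as ℕ using (ℕ)
open import Data.Product using (∃; _×_; _,_)
open import Data.Rational as ℚ using (ℚ; 0ℚ; 1ℚ)
import Data.Rational.Properties as ℚ
open import Data.Sum using (_⊎_)
open import Function.Base using (_∘_)
open import Function.Bundles using (_⇔_)
open import Level using (Level; 0ℓ) renaming (suc to lsuc)
open import Relation.Binary.Construct.Closure.ReflexiveTransitive using (Star)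
open import Relation.Binary.Core using (Rel)
open import Relation.Binary.Definitions using (Symmetric; Irreflexive)
open import Relation.Binary.PropositionalEquality using (_≡_; _≢_; refl; sym; subst)
open import Relation.Nullary using (¬_)
open import Relation.Unary using (Pred; U; _≐_)
import Relation.Unary as Unary

private variable
  ℓ ℓ₁ ℓ₂ : Level
  n : ℕ

------------------------------------------------------------------------
-- Real numbers

-- Dedekind's lower cuts of ℚ.  In the presence of excluded middle, which
-- the development assumes explicitly, these are the classical reals.

record ℝ : Set (lsuc 0ℓ) where
  field
    lower      : Pred ℚ 0ℓ
    nonempty   : ∃ lower
    bounded    : ∃ λ q → ¬ lower q
    downward   : ∀ {p q} → p ℚ.< q → lower q → lower p
    no-maximum : ∀ {q} → lower q → ∃ λ r → q ℚ.< r × lower r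

open ℝ public using (lower)

infix 4 _≈ᵣ_ _<ᵣ_ _≤ᵣ_

_≈ᵣ_ : Rel ℝ 0ℓ
x ≈ᵣ y = lower x ≐ lower y

_≤ᵣ_ : Rel ℝ 0ℓ
x ≤ᵣ y = lower x Unary.⊆ lower y

_<ᵣ_ : Rel ℝ 0ℓ
x <ᵣ y = ∃ λ q → lower y q × ¬ lower x q

fromℚ : ℚ → ℝ
fromℚ q = record
  { lower      = ℚ._< q
  ; nonempty   = q ℚ.- 1ℚ
               , subst (q ℚ.- 1ℚ ℚ.<_) (ℚ.+-identityʳ q)
                   (ℚ.+-monoʳ-< q (ℚ.negative⁻¹ (ℚ.- 1ℚ)))
  ; bounded    = q , ℚ.<-irrefl refl
  ; downward   = ℚ.<-trans
  ; no-maximum = λ p<q → let (r , p<r , r<q) = ℚ.<-dense p<q in r , p<r , r<q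
  }

data Interval : Set where
  [0,1] line : Interval

⟦_⟧ : Interval → Pred ℝ 0ℓ
⟦ [0,1] ⟧ t = fromℚ 0ℚ ≤ᵣ t × t ≤ᵣ fromℚ 1ℚ
⟦ line  ⟧ t = U t

-- A function on the interval I is given by a map on all of ℝ whose values
-- outside I are never used.  Continuity on I is with respect to the usual
-- topologies, with the open intervals as basic open sets.  It implies that
-- f respects ≈ᵣ on I: if s ≈ᵣ t then f s lies in every open interval
-- around f t.

ContinuousOn : Pred ℝ 0ℓ → (ℝ → ℝ) → Set (lsuc 0ℓ)
ContinuousOn I f =
  ∀ t → I t → ∀ a b → a <ᵣ f t → f t <ᵣ b →
  ∃ λ c → ∃ λ d → c <ᵣ t × t <ᵣ d ×
    (∀ s → I s → c <ᵣ s → s <ᵣ d → a <ᵣ f s × f s <ᵣ b)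

------------------------------------------------------------------------
-- Graphs

record Graph (V : Set) : Set (lsuc 0ℓ) where
  field
    Adj        : Rel V 0ℓ
    adj-sym    : Symmetric Adj
    adj-irrefl : Irreflexive _≡_ Adj

open Graph public using (Adj)

-- Existence of a path in the subgraph induced on W, for endpoints in W.

Path : {V : Set} → Graph V → Pred V 0ℓ → Rel V 0ℓ
Path G W = Star (λ u v → W u × W v × Adj G u v)

Connected : {V : Set} → Graph V → Set
Connected G = ∀ u v → Path G U u v

-- K is (the vertex set of) a connected component of the subgraph of G
-- induced on W.

IsComponent : {V : Set} → Graph V → Pred V 0ℓ → Pred V 0ℓ → Set
IsComponent G W K = ∃ λ u → W u × (∀ v → K v ⇔ Path G W u v)

IsModule : Graph (Fin n) → Subset n → Set
IsModule G M =
  1 ℕ.< ∣ M ∣ ×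
  (∀ w → w ∉ M → (∀ v → v ∈ M → Adj G w v) ⊎ (∀ v → v ∈ M → ¬ Adj G w v))

NoProperModule : Graph (Fin n) → Set
NoProperModule G = ∀ M → IsModule G M → M ≡ ⊤

IsClique : Graph (Fin n) → Subset n → Set
IsClique G S = ∀ u v → u ∈ S → v ∈ S → u ≢ v → Adj G u v

IsMaximalClique : Graph (Fin n) → Subset n → Set
IsMaximalClique G S = IsClique G S × (∀ T → IsClique G T → S ⊆ T → T ≡ S)

------------------------------------------------------------------------
-- Function graphs

record FunctionRepresentation (G : Graph (Fin n)) (I : Interval) : Set (lsuc 0ℓ) where
  field
    fun        : Fin n → ℝ → ℝ
    continuous : ∀ v → ContinuousOn ⟦ I ⟧ (fun v)
    adj⇔meet   : ∀ u v → u ≢ v →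
                 Adj G u v ⇔ (∃ λ t → ⟦ I ⟧ t × fun u t ≈ᵣ fun v t)

  infix 4 _≺_

  _≺_ : Rel (Fin n) (lsuc 0ℓ)
  u ≺ v = ∀ t → ⟦ I ⟧ t → fun u t <ᵣ fun v t

  _AtLeftOf_ : Pred (Fin n) ℓ₁ → Pred (Fin n) ℓ₂ → Set _
  A AtLeftOf B = ∀ a b → A a → B b → a ≺ b

  LowerBound : Pred (Fin n) ℓ → Set _
  LowerBound S = ∀ u w → S u → ¬ S w → ¬ Adj G u w → u ≺ w

  UpperBound : Pred (Fin n) ℓ → Set _
  UpperBound S = ∀ u w → S u → ¬ S w → ¬ Adj G u w → w ≺ u

------------------------------------------------------------------------
-- The neighbors of S, the components of the rest, and the graph Q

module _ (G : Graph (Fin n)) (S : Subset n) where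

  N : Pred (Fin n) 0ℓ
  N v = v ∉ S × (∃ λ s → s ∈ S × Adj G s v)

  Rest : Pred (Fin n) 0ℓ
  Rest v = v ∉ S × ¬ N v

  𝒞 : Pred (Subset n) 0ℓ
  𝒞 C = IsComponent G Rest (_∈ C)

  -- Q is defined on all subsets; the auxiliary graph of the algorithm is
  -- its restriction to 𝒞.

  Q : Graph (Subset n)
  Q = record
    { Adj        = λ C D → C ≢ D × (∃ λ v → N v × (∃ λ x → x ∈ C × Adj G v x)
                                                × (∃ λ y → y ∈ D × Adj G v y))
    ; adj-sym    = λ (C≢D , v , Nv , toC , toD) → C≢D ∘ sym , v , Nv , toD , toC
    ; adj-irrefl = λ C≡D (C≢D , _) → C≢D C≡D
    }

  IsQComponent : Pred (Subset n) 0ℓ → Set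
  IsQComponent = IsComponent Q 𝒞

⋃ : Pred (Subset n) ℓ → Pred (Fin n) ℓ
⋃ 𝒟 v = ∃ λ C → 𝒟 C × v ∈ C

module _ {G : Graph (Fin n)} {I : Interval}
         (F : FunctionRepresentation G I) (S : Subset n) where
  open FunctionRepresentation F

  L : Pred (Fin n) (lsuc 0ℓ)
  L = ⋃ λ C → 𝒞 G S C × (_∈ C) AtLeftOf (_∈ S)

  R : Pred (Fin n) (lsuc 0ℓ)
  R = ⋃ λ C → 𝒞 G S C × (_∈ S) AtLeftOf (_∈ C)

{-# OPTIONS --safe #-}

-- For distinct non-adjacent u, v the functions of u and v never meet, so by
-- connectedness of I one lies strictly above the other: ≺ is a strict partial
-- order on V comparing exactly the distinct non-adjacent pairs.  The rest is
-- combinatorics of this order, in which S is a maximal antichain; R is treated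
-- as the L of the reversed order.
--
-- A vertex w of N(S) is incomparable to some s ∈ S and comparable to
-- another. So if x < y < S and w is adjacent to x, then w is also adjacent
-- to y: w < y would give w < s for a neighbor s of w, and y < w would give x
-- < w.  Since G is connected, every component has a neighbor in N(S), and it
-- follows that any two components in L are adjacent in Q.  On the other hand
-- a vertex of N(S) is comparable to some s ∈ S, which prevents it from
-- having neighbors on both sides of S.

module Submission where

open import Defs
open import Axiom.DoubleNegationElimination using (em⇒dne)
open import Axiom.ExcludedMiddle using (ExcludedMiddle)
open import Data.Bool.Properties using (T-≡)
open import Data.Fin using (Fin)
import Data.Fin.Properties as Fin
open import Data.Fin.Subset using (Subset; _∈_; _∉_; _∪_; ⁅_⁆)
open import Data.Fin.Subset.Properties
  using (x∈⁅x⁆; x∈⁅y⁆⇒x≡y; p⊆p∪q; q⊆p∪q; x∈p∪q⁻; ⊆-antisym)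
open import Data.Nat using (ℕ)
open import Data.Product using (∃; _×_; _,_; proj₁; proj₂)
open import Data.Rational as ℚ using (ℚ; 0ℚ; 1ℚ)
import Data.Rational.Properties as ℚ
open import Data.Sum using (_⊎_; inj₁; inj₂; [_,_]′; swap)
open import Data.Vec using (tabulate)
open import Data.Vec.Properties using (lookup∘tabulate; lookup⇒[]=; []=⇒lookup)
open import Function.Base using (_∘_; flip)
open import Function.Bundles using (_⇔_; mk⇔; Equivalence)
open import Function.Construct.Identity using (⇔-id)
open import Level using (Level; 0ℓ; Lift; lift; lower) renaming (suc to lsuc)
open import Relation.Binary.Construct.Closure.ReflexiveTransitive
  using (ε; _◅_; _◅◅_; reverse)
import Relation.Binary.Construct.Flip.EqAndOrd as Flip
open import Relation.Binary.Core using (Rel)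
open import Relation.Binary.Definitions using (tri<; tri≈; tri>)
open import Relation.Binary.PropositionalEquality
  using (_≡_; _≢_; refl; sym; trans; subst; isEquivalence; resp₂)
open import Relation.Binary.Structures using (IsStrictPartialOrder)
open import Relation.Nullary using (¬_; yes; no; contradiction)
open import Relation.Nullary.Decidable using (True; ⌊_⌋; toWitness; fromWitness; map′)
open import Relation.Unary using (Pred; U; _≐_; Satisfiable)
open import Relation.Unary.Properties using (≐-sym; ≐-trans)

open Equivalence using (to; from)

private variable
  ℓ : Level
  n : ℕ

-- Order of the reals

∉-lower⇒< : ∀ x {p q} → lower x p → ¬ lower x q → p ℚ.< q
∉-lower⇒< x {p} {q} p∈x q∉x with ℚ.<-cmp p q
... | tri< p<q _ _ = p<q
... | tri≈ _ refl _ = contradiction p∈x q∉x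
... | tri> _ _ q<p = contradiction (ℝ.downward x q<p p∈x) q∉x

<ᵣ-irrefl : ∀ x → ¬ x <ᵣ x
<ᵣ-irrefl x (q , q∈x , q∉x) = q∉x q∈x

<ᵣ⇒≤ᵣ : ∀ x y → x <ᵣ y → x ≤ᵣ y
<ᵣ⇒≤ᵣ x y (q , q∈y , q∉x) p∈x = ℝ.downward y (∉-lower⇒< x p∈x q∉x) q∈y

<ᵣ-≤ᵣ-trans : ∀ x y z → x <ᵣ y → y ≤ᵣ z → x <ᵣ z
<ᵣ-≤ᵣ-trans x y z (q , q∈y , q∉x) y≤z = q , y≤z q∈y , q∉x

≤ᵣ-<ᵣ-trans : ∀ x y z → x ≤ᵣ y → y <ᵣ z → x <ᵣ z
≤ᵣ-<ᵣ-trans x y z x≤y (q , q∈z , q∉y) = q , q∈z , q∉y ∘ x≤y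

<ᵣ-trans : ∀ x y z → x <ᵣ y → y <ᵣ z → x <ᵣ z
<ᵣ-trans x y z x<y = ≤ᵣ-<ᵣ-trans x y z (<ᵣ⇒≤ᵣ x y x<y)

fromℚ<ᵣ : ∀ x {q} → lower x q → fromℚ q <ᵣ x
fromℚ<ᵣ x {q} q∈x = q , q∈x , ℚ.<-irrefl refl

<ᵣfromℚ : ∀ x {p q} → ¬ lower x p → p ℚ.< q → x <ᵣ fromℚ q
<ᵣfromℚ x {p} p∉x p<q = p , p<q , p∉x

∃-smaller : ∀ x → ∃ (_<ᵣ x)
∃-smaller x = let (q , q∈x) = ℝ.nonempty x in fromℚ q , fromℚ<ᵣ x q∈x

∃-larger : ∀ x → ∃ (x <ᵣ_)
∃-larger x =
  let (q , q∉x) = ℝ.bounded x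
  -- A rational outside the cut may equal `x`, so a strictly larger one is taken.
  in fromℚ (q ℚ.+ 1ℚ) ,
     <ᵣfromℚ x q∉x (subst (ℚ._< q ℚ.+ 1ℚ) (ℚ.+-identityʳ q) (ℚ.+-monoʳ-< q (ℚ.positive⁻¹ 1ℚ)))

<ᵣ-dense : ∀ x y → x <ᵣ y → ∃ λ m → x <ᵣ m × m <ᵣ y
<ᵣ-dense x y (q , q∈y , q∉x) =
  let (r , q<r , r∈y) = ℝ.no-maximum y q∈y
  in fromℚ r , <ᵣfromℚ x q∉x q<r , fromℚ<ᵣ y r∈y

interval-inhabited : ∀ I → ∃ ⟦ I ⟧
interval-inhabited [0,1] = fromℚ 0ℚ , (λ q<0 → q<0) , λ q<0 → ℚ.<-trans q<0 (ℚ.positive⁻¹ 1ℚ)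
interval-inhabited line  = fromℚ 0ℚ , _

interval-convex : ∀ I {a b c} → ⟦ I ⟧ a → ⟦ I ⟧ b → a ≤ᵣ c → c ≤ᵣ b → ⟦ I ⟧ c
interval-convex [0,1] (0≤a , _) (_ , b≤1) a≤c c≤b = (λ q → a≤c (0≤a q)) , (λ q → b≤1 (c≤b q))
interval-convex line  _ _ _ _ = _

-- Connectedness of intervals

OpenIn : Pred ℝ 0ℓ → Pred ℝ 0ℓ → Set (lsuc 0ℓ)
OpenIn I P = ∀ t → I t → P t →
  ∃ λ c → ∃ λ d → c <ᵣ t × t <ᵣ d × (∀ s → I s → c <ᵣ s → s <ᵣ d → P s)

module Classical (em : ExcludedMiddle (lsuc 0ℓ)) where

  em₀ : ExcludedMiddle 0ℓ
  em₀ = map′ lower lift em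

  ≮ᵣ⇒≥ᵣ : ∀ x y → ¬ x <ᵣ y → y ≤ᵣ x
  ≮ᵣ⇒≥ᵣ x y x≮y {q} q∈y = em⇒dne em₀ λ q∉x → x≮y (q , q∈y , q∉x)

  ≤ᵣ-total : ∀ x y → x ≤ᵣ y ⊎ y ≤ᵣ x
  ≤ᵣ-total x y with em₀ {x <ᵣ y}
  ... | yes x<y = inj₁ (<ᵣ⇒≤ᵣ x y x<y)
  ... | no  x≮y = inj₂ (≮ᵣ⇒≥ᵣ x y x≮y)

  ≉ᵣ⇒≶ᵣ : ∀ x y → ¬ x ≈ᵣ y → x <ᵣ y ⊎ y <ᵣ x
  ≉ᵣ⇒≶ᵣ x y x≉y with em₀ {x <ᵣ y} | em₀ {y <ᵣ x}
  ... | yes x<y | _       = inj₁ x<y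
  ... | _       | yes y<x = inj₂ y<x
  ... | no x≮y  | no y≮x  = contradiction {A = x ≈ᵣ y} (≮ᵣ⇒≥ᵣ y x y≮x , ≮ᵣ⇒≥ᵣ x y x≮y) x≉y

  ∃-max : ∀ x y → ∃ λ m → x ≤ᵣ m × y ≤ᵣ m × (∀ z → x <ᵣ z → y <ᵣ z → m <ᵣ z)
  ∃-max x y with ≤ᵣ-total x y
  ... | inj₁ x≤y = y , x≤y , (λ q → q) , λ _ _ y<z → y<z
  ... | inj₂ y≤x = x , (λ q → q) , y≤x , λ _ x<z _ → x<z

  ∃-min : ∀ x y → ∃ λ m → m ≤ᵣ x × m ≤ᵣ y × (∀ z → z <ᵣ x → z <ᵣ y → z <ᵣ m)
  ∃-min x y with ≤ᵣ-total x y
  ... | inj₁ x≤y = x , (λ q → q) , x≤y , λ _ z<x _ → z<x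
  ... | inj₂ y≤x = y , y≤x , (λ q → q) , λ _ _ z<y → z<y

  -- A real `m` strictly between `f t` and `g t` separates the two functions near `t`: there `f`
  -- stays below `m` and `g` above it.
  <ᵣ-open : ∀ {I f g} → ContinuousOn I f → ContinuousOn I g → OpenIn I (λ t → f t <ᵣ g t)
  <ᵣ-open {I} {f} {g} f-cont g-cont t It ft<gt =
    let (m , ft<m , m<gt) = <ᵣ-dense (f t) (g t) ft<gt
        -- Continuity asks for bounds on both sides of the value; `a` and `b` fill the sides away
        -- from `m`.
        (a , a<ft) = ∃-smaller (f t)
        (b , gt<b) = ∃-larger (g t)
        (c₁ , d₁ , c₁<t , t<d₁ , f-near) = f-cont t It a m a<ft ft<m
        (c₂ , d₂ , c₂<t , t<d₂ , g-near) = g-cont t It m b m<gt gt<b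
        (c , c₁≤c , c₂≤c , c-lub) = ∃-max c₁ c₂
        (d , d≤d₁ , d≤d₂ , d-glb) = ∃-min d₁ d₂
    in c , d , c-lub t c₁<t c₂<t , d-glb t t<d₁ t<d₂ , λ s Is c<s s<d →
       <ᵣ-trans (f s) m (g s)
         (proj₂ (f-near s Is (≤ᵣ-<ᵣ-trans c₁ c s c₁≤c c<s) (<ᵣ-≤ᵣ-trans s d d₁ s<d d≤d₁)))
         (proj₁ (g-near s Is (≤ᵣ-<ᵣ-trans c₂ c s c₂≤c c<s) (<ᵣ-≤ᵣ-trans s d d₂ s<d d≤d₂)))

  -- The union of the cuts in X quantifies over ℝ; excluded middle brings it
  -- back down to level 0.
  ∃-supremum : (X : Pred ℝ (lsuc 0ℓ)) → Satisfiable X →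
               (b : ℝ) → (∀ x → X x → x ≤ᵣ b) →
               ∃ λ c → (∀ x → X x → x ≤ᵣ c) × c ≤ᵣ b × (∀ y → y <ᵣ c → ∃ λ x → X x × y <ᵣ x)
  ∃-supremum X (a , Xa) b X≤b = c , upper , c≤b , approximated
    where
    InUnion : ℚ → Set (lsuc 0ℓ)
    InUnion q = ∃ λ x → X x × lower x q

    c≤b′ : ∀ {q} → True (em {InUnion q}) → lower b q
    c≤b′ q∈c = let (x , Xx , q∈x) = toWitness q∈c in X≤b x Xx q∈x

    c : ℝ
    c = record
      { lower      = λ q → True (em {InUnion q})
      ; nonempty   = let (q , q∈a) = ℝ.nonempty a in q , fromWitness (a , Xa , q∈a)
      ; bounded    = let (q , q∉b) = ℝ.bounded b in q , q∉b ∘ c≤b′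
      ; downward   = λ p<q q∈c → let (x , Xx , q∈x) = toWitness q∈c
                                 in fromWitness (x , Xx , ℝ.downward x p<q q∈x)
      ; no-maximum = λ q∈c → let (x , Xx , q∈x) = toWitness q∈c
                                 (r , q<r , r∈x) = ℝ.no-maximum x q∈x
                             in r , q<r , fromWitness (x , Xx , r∈x)
      }

    upper : ∀ x → X x → x ≤ᵣ c
    upper x Xx q∈x = fromWitness (x , Xx , q∈x)

    c≤b : c ≤ᵣ b
    c≤b = c≤b′

    approximated : ∀ y → y <ᵣ c → ∃ λ x → X x × y <ᵣ x
    approximated y (q , q∈c , q∉y) =
      let (x , Xx , q∈x) = toWitness q∈c in x , Xx , q , q∈x , q∉y

  module _ {I : Interval} {P P′ : Pred ℝ 0ℓ}
           (P-open : OpenIn ⟦ I ⟧ P) (P′-open : OpenIn ⟦ I ⟧ P′)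
           (cover : ∀ t → ⟦ I ⟧ t → P t ⊎ P′ t) (disjoint : ∀ t → P t → ¬ P′ t) where

    -- Let `c` be the supremum of the points of `P` in `I` up to `b`. It is not in `P′`, which is
    -- open, because points of `P` come arbitrarily close to it. So a neighborhood of `c` lies in
    -- `P`, and it reaches `b`, or else it would contain a point of `P` beyond `c` and still at most
    -- `b`.
    connected-rightwards : ∀ a b → ⟦ I ⟧ a → ⟦ I ⟧ b → a ≤ᵣ b → P a → P b
    connected-rightwards a b Ia Ib a≤b Pa
      with ∃-supremum (λ x → Lift (lsuc 0ℓ) (⟦ I ⟧ x × x ≤ᵣ b × P x))
             (a , lift (Ia , a≤b , Pa)) b (λ x h → proj₁ (proj₂ (lower h)))
    ... | c , upper , c≤b , approximated with interval-convex I Ia Ib (upper a (lift (Ia , a≤b , Pa))) c≤b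
    ... | Ic with cover c Ic
    ... | inj₂ P′c =
      let (l , r , l<c , c<r , P′-near) = P′-open c Ic P′c
          (x , h , l<x) = approximated l l<c
          (Ix , x≤b , Px) = lower h
      in contradiction (P′-near x Ix l<x (≤ᵣ-<ᵣ-trans x c r (upper x h) c<r)) (disjoint x Px)
    ... | inj₁ Pc with P-open c Ic Pc
    ... | l , r , l<c , c<r , P-near with em₀ {b <ᵣ r}
    ... | yes b<r = P-near b Ib (<ᵣ-≤ᵣ-trans l c b l<c c≤b) b<r
    ... | no  b≮r =
      let (m , c<m , m<r) = <ᵣ-dense c r c<r
          m≤b = λ {q} q∈m → ≮ᵣ⇒≥ᵣ b r b≮r {q} (<ᵣ⇒≤ᵣ m r m<r {q} q∈m)
          Im  = interval-convex I Ic Ib (<ᵣ⇒≤ᵣ c m c<m) m≤b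
          Pm  = P-near m Im (<ᵣ-trans l c m l<c c<m) m<r
      in contradiction (<ᵣ-≤ᵣ-trans c m c c<m (upper m (lift (Im , m≤b , Pm)))) (<ᵣ-irrefl c)

  -- If `b` is to the left of `a` and in `P′`, moving rightwards from `b` with `P` and `P′`
  -- exchanged puts `a` in `P′`.
  interval-connected :
    ∀ {I P P′} → OpenIn ⟦ I ⟧ P → OpenIn ⟦ I ⟧ P′ →
    (∀ t → ⟦ I ⟧ t → P t ⊎ P′ t) → (∀ t → P t → ¬ P′ t) →
    ∀ a b → ⟦ I ⟧ a → ⟦ I ⟧ b → P a → P b
  interval-connected {I} P-open P′-open cover disjoint a b Ia Ib Pa
    with ≤ᵣ-total a b | cover b Ib
  ... | inj₁ a≤b | _        = connected-rightwards {I} P-open P′-open cover disjoint a b Ia Ib a≤b Pa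
  ... | inj₂ b≤a | inj₁ Pb  = Pb
  ... | inj₂ b≤a | inj₂ P′b =
    contradiction
      (connected-rightwards {I} P′-open P-open (λ t It → swap (cover t It))
        (λ t P′t Pt → disjoint t Pt P′t) b a Ib Ia b≤a P′b)
      (disjoint a Pa)

  -- The sets where `f` is below `g` and where it is above are open, disjoint and cover `I`, so the
  -- order at one point `o` holds throughout.
  never-meet⇒ordered :
    ∀ {I f g} → ContinuousOn ⟦ I ⟧ f → ContinuousOn ⟦ I ⟧ g →
    (∀ t → ⟦ I ⟧ t → ¬ f t ≈ᵣ g t) →
    (∀ t → ⟦ I ⟧ t → f t <ᵣ g t) ⊎ (∀ t → ⟦ I ⟧ t → g t <ᵣ f t)
  never-meet⇒ordered {I} {f} {g} f-cont g-cont f≉g =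
    let (o , Io) = interval-inhabited I
        f<g-open = <ᵣ-open {⟦ I ⟧} {f} {g} f-cont g-cont
        g<f-open = <ᵣ-open {⟦ I ⟧} {g} {f} g-cont f-cont
        cover    = λ t It → ≉ᵣ⇒≶ᵣ (f t) (g t) (f≉g t It)
        disjoint = λ t f<g g<f → <ᵣ-irrefl (f t) (<ᵣ-trans (f t) (g t) (f t) f<g g<f)
    in [ (λ fo<go → inj₁ λ t It →
            interval-connected {I} f<g-open g<f-open cover disjoint o t Io It fo<go)
       , (λ go<fo → inj₂ λ t It →
            interval-connected {I} g<f-open f<g-open (λ s Is → swap (cover s Is))
              (λ s g<f f<g → disjoint s f<g g<f) o t Io It go<fo)
       ]′ (cover o Io)

  -- Turns a component, given by the existence of paths, into a Boolean vector, as membership in `𝒞`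
  -- requires.
  ∃-subset : (P : Pred (Fin n) 0ℓ) → ∃ λ C → ∀ v → v ∈ C ⇔ P v
  ∃-subset P = tabulate inP , λ v → mk⇔
      (λ v∈C → toWitness {a? = em₀} (from T-≡ (trans (sym (lookup∘tabulate inP v)) ([]=⇒lookup v∈C))))
      (λ Pv → lookup⇒[]= v _ (trans (lookup∘tabulate inP v) (to T-≡ (fromWitness {a? = em₀} Pv))))
    where inP = λ v → ⌊ em₀ {P v} ⌋

-- Cliques, paths and components

clique-∪⁅⁆ : ∀ {G : Graph (Fin n)} {S v} → IsClique G S → (∀ s → s ∈ S → Adj G s v) →
             IsClique G (S ∪ ⁅ v ⁆)
clique-∪⁅⁆ {G = G} {S} {v} clique adj x y x∈ y∈ x≢y with x∈p∪q⁻ S ⁅ v ⁆ x∈ | x∈p∪q⁻ S ⁅ v ⁆ y∈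
... | inj₁ x∈S | inj₁ y∈S = clique x y x∈S y∈S x≢y
... | inj₁ x∈S | inj₂ y∈v rewrite x∈⁅y⁆⇒x≡y v y∈v = adj x x∈S
... | inj₂ x∈v | inj₁ y∈S rewrite x∈⁅y⁆⇒x≡y v x∈v = Graph.adj-sym G (adj y y∈S)
... | inj₂ x∈v | inj₂ y∈v =
  contradiction (trans (x∈⁅y⁆⇒x≡y v x∈v) (sym (x∈⁅y⁆⇒x≡y v y∈v))) x≢y

module _ {V : Set} {G : Graph V} {W : Pred V 0ℓ} where

  path-sym : ∀ {u v} → Path G W u v → Path G W v u
  path-sym = reverse λ (Wu , Wv , uv) → Wv , Wu , Graph.adj-sym G uv

  path-end : ∀ {u v} → W u → Path G W u v → W v
  path-end Wu ε                     = Wu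
  path-end Wu ((_ , Wv , _) ◅ path) = path-end Wv path

-- Left G S _<_ is L of the paper for _<_ = ≺, and R for _<_ = flip ≺.
Left : (G : Graph (Fin n)) (S : Subset n) → Rel (Fin n) ℓ → Pred (Fin n) ℓ
Left G S _<_ v = Rest G S v × (∀ s → s ∈ S → v < s)

-- A transitive orientation of the complement of `G`. This is all that the combinatorial part knows
-- of the functions, and it is invariant under reversing the order.
record OrientsComplement (G : Graph (Fin n)) (_<_ : Rel (Fin n) ℓ) : Set ℓ where
  field
    isStrictPartialOrder : IsStrictPartialOrder _≡_ _<_
    adj⇒≮                : ∀ {u v} → Adj G u v → ¬ u < v
    ¬adj⇒≶               : ∀ {u v} → u ≢ v → ¬ Adj G u v → u < v ⊎ v < u

  <-trans : ∀ {u v w} → u < v → v < w → u < w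
  <-trans = IsStrictPartialOrder.trans isStrictPartialOrder

  <-irrefl : ∀ {u} → ¬ u < u
  <-irrefl = IsStrictPartialOrder.irrefl isStrictPartialOrder refl

flip-orientsComplement : ∀ {G : Graph (Fin n)} {_<_ : Rel (Fin n) ℓ} →
                         OrientsComplement G _<_ → OrientsComplement G (flip _<_)
flip-orientsComplement {G = G} O = record
  { isStrictPartialOrder = Flip.isStrictPartialOrder (OrientsComplement.isStrictPartialOrder O)
  ; adj⇒≮  = OrientsComplement.adj⇒≮ O ∘ Graph.adj-sym G
  ; ¬adj⇒≶ = λ u≢v ¬uv → swap (OrientsComplement.¬adj⇒≶ O u≢v ¬uv)
  }

-- Components away from a maximal clique

module MaximalClique (em : ExcludedMiddle (lsuc 0ℓ)) {G : Graph (Fin n)}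
                     (connected : Connected G) {S : Subset n} (max : IsMaximalClique G S) where
  open Classical em

  -- Otherwise adding `v` would give a larger clique. It also serves as the source of elements of
  -- `S`.
  missed : ∀ {v} → v ∉ S → ∃ λ s → s ∈ S × ¬ Adj G s v
  missed {v} v∉S = em⇒dne em₀ λ ¬missed →
    let adj   = λ s s∈S → em⇒dne em₀ λ ¬sv → ¬missed (s , s∈S , ¬sv)
        S∪v≡S = proj₂ max (S ∪ ⁅ v ⁆) (clique-∪⁅⁆ {G = G} (proj₁ max) adj) (p⊆p∪q ⁅ v ⁆)
    in v∉S (subst (v ∈_) S∪v≡S (q⊆p∪q S ⁅ v ⁆ (x∈⁅x⁆ v)))

  ∈⇒≢ : ∀ {v s} → v ∉ S → s ∈ S → v ≢ s
  ∈⇒≢ v∉S s∈S refl = v∉S s∈S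

  rest-¬adj : ∀ {v s} → Rest G S v → s ∈ S → ¬ Adj G v s
  rest-¬adj (v∉S , ¬Nv) s∈S vs = ¬Nv (v∉S , _ , s∈S , Graph.adj-sym G vs)

  ∃-component : ∀ {v} → Rest G S v → ∃ λ C → 𝒞 G S C × v ∈ C
  ∃-component {v} Rv =
    let (C , C-def) = ∃-subset (Path G (Rest G S) v) in C , (v , Rv , C-def) , from (C-def v) ε

  component⊆rest : ∀ {C v} → 𝒞 G S C → v ∈ C → Rest G S v
  component⊆rest {v = v} (u , Ru , C-def) v∈C = path-end {G = G} Ru (to (C-def v) v∈C)

  component-joined : ∀ {C v w} → 𝒞 G S C → v ∈ C → w ∈ C → Path G (Rest G S) v w
  component-joined {v = v} {w} (u , _ , C-def) v∈C w∈C =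
    path-sym {G = G} (to (C-def v) v∈C) ◅◅ to (C-def w) w∈C

  component-closed : ∀ {C v w} → 𝒞 G S C → v ∈ C → Path G (Rest G S) v w → w ∈ C
  component-closed {v = v} {w} (u , _ , C-def) v∈C v⟶w = from (C-def w) (to (C-def v) v∈C ◅◅ v⟶w)

  components-meet : ∀ {C D v w} → 𝒞 G S C → 𝒞 G S D → v ∈ C → w ∈ D →
                    Path G (Rest G S) v w → C ≡ D
  components-meet 𝒞C 𝒞D v∈C w∈D v⟶w = ⊆-antisym
    (λ x∈C → component-closed 𝒞D w∈D
               (path-sym {G = G} v⟶w ◅◅ component-joined 𝒞C v∈C x∈C))
    (λ x∈D → component-closed 𝒞C v∈C (v⟶w ◅◅ component-joined 𝒞D w∈D x∈D))

  -- Follow a path of `G` from `C` to `S`. Until it meets N(S) it stays in `C`, and it cannot step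
  -- from `C` directly into `S`.
  ∃-neighbor : ∀ {C} → 𝒞 G S C → ∃ λ x → x ∈ C × (∃ λ p → N G S p × Adj G p x)
  ∃-neighbor {C} 𝒞C@(u , Ru , C-def) =
    let (s , s∈S , _) = missed (proj₁ Ru)
    in exit s∈S (from (C-def u) ε) (connected u s)
    where
    exit : ∀ {x s} → s ∈ S → x ∈ C → Path G U x s → ∃ λ x → x ∈ C × (∃ λ p → N G S p × Adj G p x)
    exit s∈S x∈C ε = contradiction s∈S (proj₁ (component⊆rest 𝒞C x∈C))
    exit {x} s∈S x∈C (_◅_ {j = y} (_ , _ , xy) y⟶s) with em₀ {N G S y}
    ... | yes Ny = x , x∈C , y , Ny , Graph.adj-sym G xy
    ... | no ¬Ny =
      let Rx  = component⊆rest 𝒞C x∈C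
          y∉S = λ y∈S → rest-¬adj Rx y∈S xy
      in exit s∈S (component-closed 𝒞C x∈C ((Rx , (y∉S , ¬Ny) , xy) ◅ ε)) y⟶s

  -- The two sides of the clique

  module Orientation {_<_ : Rel (Fin n) ℓ} (orients : OrientsComplement G _<_) where
    open OrientsComplement orients

    -- If `v` were above one element of `S` and below another, these two would be comparable by
    -- transitivity, but they are equal or adjacent.
    left⊎right : ∀ {v} → Rest G S v → Left G S _<_ v ⊎ Left G S (flip _<_) v
    left⊎right {v} Rv@(v∉S , _) =
      let (s , s∈S , _) = missed v∉S
      in [ (λ v<s → inj₁ (Rv , λ s′ s′∈S →
              [ (λ v<s′ → v<s′) , (λ s′<v → contradiction (<-trans s′<v v<s) (incomparable s′∈S s∈S)) ]′
              (compare s′∈S)))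
         , (λ s<v → inj₂ (Rv , λ s′ s′∈S →
              [ (λ v<s′ → contradiction (<-trans s<v v<s′) (incomparable s∈S s′∈S)) , (λ s′<v → s′<v) ]′
              (compare s′∈S)))
         ]′ (compare s∈S)
      where
      compare : ∀ {s} → s ∈ S → v < s ⊎ s < v
      compare s∈S = ¬adj⇒≶ (∈⇒≢ v∉S s∈S) (rest-¬adj Rv s∈S)

      incomparable : ∀ {s s′} → s ∈ S → s′ ∈ S → ¬ s < s′
      incomparable {s} {s′} s∈S s′∈S with s Fin.≟ s′
      ... | yes refl = <-irrefl
      ... | no s≢s′  = adj⇒≮ (proj₁ max s s′ s∈S s′∈S s≢s′)

    left-≮-right : ∀ {u v} → Left G S _<_ u → Left G S (flip _<_) v → u < v
    left-≮-right ((u∉S , _) , u<S) (_ , S<v) =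
      let (s , s∈S , _) = missed u∉S in <-trans (u<S s s∈S) (S<v s s∈S)

    left-adj : ∀ {u v} → Left G S _<_ u → Rest G S v → Adj G u v → Left G S _<_ v
    left-adj Lu Rv uv =
      [ (λ Lv → Lv) , (λ v-right → contradiction (left-≮-right Lu v-right) (adj⇒≮ uv)) ]′ (left⊎right Rv)

    left-path : ∀ {u v} → Left G S _<_ u → Path G (Rest G S) u v → Left G S _<_ v
    left-path Lu ε = Lu
    left-path Lu ((_ , Rv , uv) ◅ path) = left-path (left-adj Lu Rv uv) path

    left-component : ∀ {C u v} → 𝒞 G S C → u ∈ C → v ∈ C → Left G S _<_ u → Left G S _<_ v
    left-component 𝒞C u∈C v∈C Lu = left-path Lu (component-joined 𝒞C u∈C v∈C)

    -- If `w < u`, then `w` is below all of `S`, hence neither in `S` nor adjacent to it, and so on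
    -- the left itself.
    left-lowerBound : ∀ {u w} → Left G S _<_ u → ¬ Left G S _<_ w → ¬ Adj G u w → u < w
    left-lowerBound {u} {w} Lu@(_ , u<S) ¬Lw ¬uw =
      [ (λ u<w → u<w) , (λ w<u → contradiction (left w<u) ¬Lw) ]′ (¬adj⇒≶ (λ { refl → ¬Lw Lu }) ¬uw)
      where
      left : w < u → Left G S _<_ w
      left w<u = ( (λ w∈S → <-irrefl (w<S w w∈S))
                 , (λ (_ , s , s∈S , sw) → adj⇒≮ (Graph.adj-sym G sw) (w<S s s∈S)))
               , w<S
        where w<S = λ s s∈S → <-trans w<u (u<S s s∈S)

    -- Take `s` in `S` not adjacent to `p`. If `y` were on the right, `p < s` would give `p < y`,
    -- and `s < p` would give `x < p`, against adjacency.
    left-neighbor : ∀ {p x y} → N G S p → Left G S _<_ x → Adj G p x →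
                    Rest G S y → Adj G p y → Left G S _<_ y
    left-neighbor {p} {x} {y} (p∉S , _) (_ , x<S) px Ry py with left⊎right Ry
    ... | inj₁ Ly = Ly
    ... | inj₂ (_ , S<y) =
      let (s , s∈S , ¬sp) = missed p∉S
      in [ (λ p<s → contradiction (<-trans p<s (S<y s s∈S)) (adj⇒≮ py))
         , (λ s<p → contradiction (<-trans (x<S s s∈S) s<p) (adj⇒≮ (Graph.adj-sym G px)))
         ]′ (¬adj⇒≶ (∈⇒≢ p∉S s∈S) (¬sp ∘ Graph.adj-sym G))

    neighbor-upward : ∀ {p x y} → N G S p → Left G S _<_ y → Adj G p x → x < y → Adj G p y
    neighbor-upward {p} {x} {y} Np@(p∉S , s , s∈S , sp) ((_ , ¬Ny) , y<S) px x<y = em⇒dne em₀ λ ¬py →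
      [ (λ p<y → adj⇒≮ (Graph.adj-sym G sp) (<-trans p<y (y<S s s∈S)))
      , (λ y<p → adj⇒≮ (Graph.adj-sym G px) (<-trans x<y y<p))
      ]′ (¬adj⇒≶ (λ { refl → ¬Ny Np }) ¬py)

    -- Both components have a vertex with a neighbor in N(S). These vertices, `x` and `y`, are
    -- comparable, lying in different components, and the neighbor of the smaller is adjacent to the
    -- larger too.
    left-Q-adj : ∀ {C D u v} → 𝒞 G S C → 𝒞 G S D → C ≢ D → u ∈ C → v ∈ D →
                 Left G S _<_ u → Left G S _<_ v → Adj (Q G S) C D
    left-Q-adj {C} {D} 𝒞C 𝒞D C≢D u∈C v∈D Lu Lv =
      let
        (x , x∈C , p , Np , px) = ∃-neighbor 𝒞C
        (y , y∈D , q , Nq , qy) = ∃-neighbor 𝒞D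
        Lx = left-component 𝒞C u∈C x∈C Lu
        Ly = left-component 𝒞D v∈D y∈D Lv

        apart : ¬ Path G (Rest G S) x y
        apart = C≢D ∘ components-meet 𝒞C 𝒞D x∈C y∈D
      in C≢D ,
         [ (λ x<y → p , Np , (x , x∈C , px) , (y , y∈D , neighbor-upward Np Ly px x<y))
         , (λ y<x → q , Nq , (x , x∈C , neighbor-upward Nq Lx qy y<x) , (y , y∈D , qy))
         ]′ (¬adj⇒≶ (λ x≡y → apart (subst (Path G (Rest G S) x) x≡y ε))
                     (λ xy → apart ((proj₁ Lx , proj₁ Ly , xy) ◅ ε)))

    left-Q-path : ∀ {C D u v} → Path (Q G S) (𝒞 G S) C D → u ∈ C → v ∈ D → 𝒞 G S C →
                  Left G S _<_ u → Left G S _<_ v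
    left-Q-path ε u∈C v∈C 𝒞C Lu = left-component 𝒞C u∈C v∈C Lu
    left-Q-path ((_ , 𝒞E , _ , p , Np , (x , x∈C , px) , (y , y∈E , py)) ◅ path) u∈C v∈D 𝒞C Lu =
      left-Q-path path y∈E v∈D 𝒞E
        (left-neighbor Np (left-component 𝒞C u∈C x∈C Lu) px (component⊆rest 𝒞E y∈E) py)

    -- Paths of `Q` never change sides; conversely, every component on the left equals `C` or is
    -- adjacent to it in `Q`.
    Q-component-of-left : ∀ {𝒟 : Pred (Subset n) 0ℓ} {C u} →
                          𝒞 G S C → (∀ D → 𝒟 D ⇔ Path (Q G S) (𝒞 G S) C D) →
                          u ∈ C → Left G S _<_ u → ⋃ 𝒟 ≐ Left G S _<_
    Q-component-of-left {𝒟} {C} {u} 𝒞C 𝒟-def u∈C Lu =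
        (λ (D , 𝒟D , v∈D) → left-Q-path (to (𝒟-def D) 𝒟D) u∈C v∈D 𝒞C Lu) , covered
      where
      covered : ∀ {v} → Left G S _<_ v → ⋃ 𝒟 v
      covered {v} Lv with ∃-component (proj₁ Lv)
      ... | D , 𝒞D , v∈D = D , from (𝒟-def D) path , v∈D
        where
        path : Path (Q G S) (𝒞 G S) C D
        path with em₀ {C ≡ D}
        ... | yes refl = ε
        ... | no C≢D   = (𝒞C , 𝒞D , left-Q-adj 𝒞C 𝒞D C≢D u∈C v∈D Lu Lv) ◅ ε

    ∃-Q-component-of-left : Satisfiable (Left G S _<_) →
                            ∃ λ 𝒟 → IsQComponent G S 𝒟 × ⋃ 𝒟 ≐ Left G S _<_
    ∃-Q-component-of-left (v , Lv) =
      let (C , 𝒞C , v∈C) = ∃-component (proj₁ Lv)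
          𝒟-def = λ D → ⇔-id (Path (Q G S) (𝒞 G S) C D)
      in Path (Q G S) (𝒞 G S) C , (C , 𝒞C , 𝒟-def) , Q-component-of-left 𝒞C 𝒟-def v∈C Lv

-- Application to function graphs

mainTheorem4 : ExcludedMiddle (lsuc 0ℓ) →
    ∀ (n : ℕ) (G : Graph (Fin n)) (I : Interval) (F : FunctionRepresentation G I) →
    Connected G →
    NoProperModule G →
    ∀ (S : Subset n) → IsMaximalClique G S →
    let open FunctionRepresentation F in
    LowerBound (L F S) ×
    UpperBound (R F S) ×
    (∀ (𝒞′ : Pred (Subset n) 0ℓ) → IsQComponent G S 𝒞′ →
    (Satisfiable (L F S) × ⋃ 𝒞′ ≐ L F S) ⊎ (Satisfiable (R F S) × ⋃ 𝒞′ ≐ R F S)) ×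
    (Satisfiable (L F S) → ∃ λ (𝒞′ : Pred (Subset n) 0ℓ) → IsQComponent G S 𝒞′ × ⋃ 𝒞′ ≐ L F S) ×
    (Satisfiable (R F S) → ∃ λ (𝒞′ : Pred (Subset n) 0ℓ) → IsQComponent G S 𝒞′ × ⋃ 𝒞′ ≐ R F S)
mainTheorem4 em n G I F connected _ S max =
    (λ u w Lu ¬Lw → ≺-side.left-lowerBound (proj₁ L≐ Lu) (¬Lw ∘ proj₂ L≐))
  , (λ u w Ru ¬Rw → ≻-side.left-lowerBound (proj₁ R≐ Ru) (¬Rw ∘ proj₂ R≐))
  , Q-component
  , (λ (v , Lv) → let (𝒟 , 𝒟-comp , eq) = ≺-side.∃-Q-component-of-left (v , proj₁ L≐ Lv)
                  in 𝒟 , 𝒟-comp , ≐-trans eq (≐-sym L≐))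
  , (λ (v , Rv) → let (𝒟 , 𝒟-comp , eq) = ≻-side.∃-Q-component-of-left (v , proj₁ R≐ Rv)
                  in 𝒟 , 𝒟-comp , ≐-trans eq (≐-sym R≐))
  where
  open FunctionRepresentation F
  open Classical em
  open MaximalClique em {G = G} connected {S} max

  -- A point of `I` is needed, since over an empty interval `≺` would hold vacuously.
  ≺-irrefl : ∀ {u} → ¬ u ≺ u
  ≺-irrefl {u} u≺u = let (o , Io) = interval-inhabited I in <ᵣ-irrefl (fun u o) (u≺u o Io)

  ≺-orientsComplement : OrientsComplement G _≺_
  ≺-orientsComplement = record
    { isStrictPartialOrder = record
      { isEquivalence = isEquivalence
      ; irrefl        = λ { refl → ≺-irrefl }
      ; trans         = λ {u} {v} {w} u≺v v≺w t It →
                          <ᵣ-trans (fun u t) (fun v t) (fun w t) (u≺v t It) (v≺w t It)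
      ; <-resp-≈      = resp₂ _≺_
      }
    ; adj⇒≮  = λ {u} {v} uv u≺v →
        let (t , It , _ , v≤u) = to (adj⇔meet u v λ u≡v → Graph.adj-irrefl G u≡v uv) uv
        in <ᵣ-irrefl (fun u t) (<ᵣ-≤ᵣ-trans (fun u t) (fun v t) (fun u t) (u≺v t It) v≤u)
    ; ¬adj⇒≶ = λ {u} {v} u≢v ¬uv →
        never-meet⇒ordered {I} {fun u} {fun v} (continuous u) (continuous v)
          λ t It u≈v → ¬uv (from (adj⇔meet u v u≢v) (t , It , u≈v))
    }

  module ≺-side = Orientation ≺-orientsComplement
  module ≻-side = Orientation (flip-orientsComplement ≺-orientsComplement)

  -- `L` asks for a whole component to the left of `S`; one vertex on the left suffices, because the
  -- side is constant on components.
  L≐ : L F S ≐ Left G S _≺_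
  L≐ = (λ {v} (C , (𝒞C , C≺S) , v∈C) → component⊆rest 𝒞C v∈C , λ s → C≺S v s v∈C)
     , λ Lv → let (C , 𝒞C , v∈C) = ∃-component (proj₁ Lv)
              in C , (𝒞C , λ a s a∈C → proj₂ (≺-side.left-component 𝒞C v∈C a∈C Lv) s) , v∈C

  R≐ : R F S ≐ Left G S (flip _≺_)
  R≐ = (λ {v} (C , (𝒞C , S≺C) , v∈C) → component⊆rest 𝒞C v∈C , λ s s∈S → S≺C s v s∈S v∈C)
     , λ Rv → let (C , 𝒞C , v∈C) = ∃-component (proj₁ Rv)
              in C , (𝒞C , λ s a s∈S a∈C → proj₂ (≻-side.left-component 𝒞C v∈C a∈C Rv) s s∈S) , v∈C

  -- The side of a single vertex `u` of the starting component `C` decides between `L` and `R`, and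
  -- `u` also witnesses that this set is nonempty.
  Q-component : ∀ 𝒟 → IsQComponent G S 𝒟 →
                (Satisfiable (L F S) × ⋃ 𝒟 ≐ L F S) ⊎ (Satisfiable (R F S) × ⋃ 𝒟 ≐ R F S)
  Q-component 𝒟 (C , 𝒞C@(u , Ru , C-def) , 𝒟-def) =
    [ (λ Lu → inj₁ ((u , proj₂ L≐ Lu) ,
                    ≐-trans (≺-side.Q-component-of-left 𝒞C 𝒟-def u∈C Lu) (≐-sym L≐)))
    , (λ Uu → inj₂ ((u , proj₂ R≐ Uu) ,
                    ≐-trans (≻-side.Q-component-of-left 𝒞C 𝒟-def u∈C Uu) (≐-sym R≐)))
    ]′ (≺-side.left⊎right Ru)
    where u∈C = from (C-def u) ε
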